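{- For every $\Gamma\cup\{\varphi\}\subseteq For(\Sigma)$, if $\Gamma\vdash_{DmbC}\varphi$, then $\Gamma\vDash_{DmbC}\varphi$.
   Context: **Syntax.** $For(\Sigma)$ is the set of formulas generated from a denumerable set of propositional variables by the signature $\Sigma=\{\to,\neg,\lor,\land,\mathsf{O},\circ\}$ ($\neg,\mathsf{O},\circ$ unary; $\to,\lor,\land$ binary). **The logic $DmbC$.** Hilbert calculus whose axiom schemas are those of $CPL^+$, the positive fragment of classical propositional logic in $\to,\land,\lor$ (for instance: $\alpha\to(\beta\to\alpha)$; $(\alpha\to(\beta\to\gamma))\to((\alpha\to\beta)\to(\alpha\to\gamma))$; $\alpha\to(\beta\to(\alpha\land\beta))$; $(\alpha\land\beta)\to\alpha$; $(\alpha\land\beta)\to\beta$; $\alpha\to(\alpha\lor\beta)$; $\beta\to(\alpha\lor\beta)$; $(\alpha\to\gamma)\to((\beta\to\gamma)\to((\alpha\lor\beta)\to\gamma))$; $\alpha\lor(\alpha\to\beta)$), plus - (EM) $\alpha\lor\neg\alpha$; - (bc) $\circ\alpha\to(\alpha\to(\neg\alpha\to\beta))$; - ($\mathsf{O}$-K) $\mathsf{O}(\alpha\to\beta)\to(\mathsf{O}\alpha\to\mathsf{O}\beta)$; - ($\mathsf{O}$-E) $\mathsf{O}\bot_\alpha\to\bot_\alpha$, where $\bot_\alpha:=(\alpha\land\neg\alpha)\land\circ\alpha$. The rules are Modus Ponens and $\mathsf{O}$-necessitation (from $\varphi$ infer $\mathsf{O}\varphi$). $\vdash_{DmbC}\varphi$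 means that there is a finite derivation of $\varphi$ from axioms (no premises) using these rules. $\Gamma\vdash_{DmbC}\varphi$ means: either $\vdash_{DmbC}\varphi$, or there are $\gamma_1,\dots,\gamma_k\in\Gamma$ ($k\ge 1$ finite) with $\vdash_{DmbC}(\gamma_1\land\dots\land\gamma_k)\to\varphi$. **Semantics.** Let $A=\{T,t,F\}$ with $T=(1,0)$, $t=(1,1)$, $F=(0,1)$; for $a\in A$ write $a=(a_1,a_2)$. Designated values: $\mathcal{D}=\{T,t\}$. Let $\sqcap,\sqcup,\supset,{\sim}$ be the Boolean meet, join, implication and complement on $\{0,1\}$, and $\bigwedge$ the meet of a non-empty subset of $\{0,1\}$. For $a,b\in A$ and $\emptyset\neq X\subseteq A$: - $a\,\tilde\land\,b=\{c\in A: c_1=a_1\sqcap b_1\}$; - $a\,\tilde\lor\,b=\{c\in A: c_1=a_1\sqcup b_1\}$; - $a\,\tilde\to\,b=\{c\in A: c_1=a_1\supset b_1\}$; - $\tilde\neg a=\{c\in A: c_1=a_2\}$; - $\tilde\circ a=\{c\in A: c_1\le{\sim}(a_1\sqcap a_2)\}$; - $\tilde{\mathsf{O}}(X)=\{c\in A: c_1=\bigwedge\{x_1:x\in X\}\}$. A swap Kripke model for $DmbC$ is a triple $\langle W,R,\{v_w\}_{w\in W}\rangle$ where $W\ne\emptyset$, $R\subseteq W^2$ is serial (every $w$ has some $w'$ with $wRw'$), and each $v_w:For(\Sigma)\to A$ satisfies, for all $\alpha,\beta$: $v_w(\alpha\#\beta)\in v_w(\alpha)\,\tilde\#\,v_w(\beta)$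 for $\#\in\{\land,\lor,\to\}$; $v_w(\neg\alpha)\in\tilde\neg v_w(\alpha)$; $v_w(\circ\alpha)\in\tilde\circ v_w(\alpha)$; $v_w(\mathsf{O}\alpha)\in\tilde{\mathsf{O}}(\{v_{w'}(\alpha): wRw'\})$. $\mathcal{M},w\vDash\alpha$ means $v_w(\alpha)\in\mathcal{D}$; $\mathcal{M},w\vDash\Gamma$ means $\mathcal{M},w\vDash\gamma$ for all $\gamma\in\Gamma$. $\Gamma\vDash_{DmbC}\alpha$ means: for every swap Kripke model $\mathcal{M}$ for $DmbC$ and every world $w$ of it, $\mathcal{M},w\vDash\Gamma$ implies $\mathcal{M},w\vDash\alpha$. -}

module Defs where

open import Data.Bool.Base as Bool using (Bool; true; false; not)
open import Data.List.NonEmpty.Base using (List⁺; foldr₁)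
open import Data.List.NonEmpty.Relation.Unary.All using (All)
open import Data.Nat.Base using (ℕ)
open import Data.Product.Base using (∃; ∃-syntax; _×_)
open import Data.Sum.Base using (_⊎_)
open import Level using (Level; 0ℓ; _⊔_) renaming (suc to lsuc)
open import Relation.Binary.Core using (Rel)
open import Relation.Binary.PropositionalEquality.Core using (_≡_)
open import Relation.Unary using (Pred; _∈_)

infixr 9 ¬_ O_ ∘_
infixr 7 _∧_
infixr 6 _∨_
infixr 5 _⇒_

data For : Set where
  var         : ℕ → For
  _⇒_ _∧_ _∨_ : For → For → For
  ¬_ O_ ∘_    : For → For

⊥[_] : For → For
⊥[ α ] = (α ∧ ¬ α) ∧ ∘ α

infix 3 ⊢_

data Axiom : Pred For 0ℓ where
  ⇒-K  : ∀ α β   → Axiom (α ⇒ (β ⇒ α))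
  ⇒-S  : ∀ α β γ → Axiom ((α ⇒ (β ⇒ γ)) ⇒ ((α ⇒ β) ⇒ (α ⇒ γ)))
  ∧-I  : ∀ α β   → Axiom (α ⇒ (β ⇒ (α ∧ β)))
  ∧-E₁ : ∀ α β   → Axiom ((α ∧ β) ⇒ α)
  ∧-E₂ : ∀ α β   → Axiom ((α ∧ β) ⇒ β)
  ∨-I₁ : ∀ α β   → Axiom (α ⇒ (α ∨ β))
  ∨-I₂ : ∀ α β   → Axiom (β ⇒ (α ∨ β))
  ∨-E  : ∀ α β γ → Axiom ((α ⇒ γ) ⇒ ((β ⇒ γ) ⇒ ((α ∨ β) ⇒ γ)))
  ∨-⇒  : ∀ α β   → Axiom (α ∨ (α ⇒ β))
  EM   : ∀ α     → Axiom (α ∨ ¬ α)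
  bc   : ∀ α β   → Axiom (∘ α ⇒ (α ⇒ (¬ α ⇒ β)))
  O-K  : ∀ α β   → Axiom (O (α ⇒ β) ⇒ (O α ⇒ O β))
  O-E  : ∀ α     → Axiom (O ⊥[ α ] ⇒ ⊥[ α ])

data ⊢_ : Pred For 0ℓ where
  ax  : ∀ {α}   → Axiom α → ⊢ α
  MP  : ∀ {α β} → ⊢ α → ⊢ (α ⇒ β) → ⊢ β
  nec : ∀ {α}   → ⊢ α → ⊢ O α

⋀ : List⁺ For → For
⋀ = foldr₁ _∧_

infix 3 _⊢_

-- Necessitation applies to theorems only: premises enter solely through
-- the antecedent of a provable implication.
_⊢_ : ∀ {ℓ} → Pred For ℓ → For → Set ℓ
Γ ⊢ φ = (⊢ φ) ⊎ (∃[ γs ] (All Γ γs × ⊢ (⋀ γs ⇒ φ)))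

data A : Set where
  T t F : A

infix 10 _₁ _₂

_₁ : A → Bool
T ₁ = true
t ₁ = true
F ₁ = false

_₂ : A → Bool
T ₂ = false
t ₂ = true
F ₂ = true

𝒟 : Pred A 0ℓ
𝒟 a = (a ≡ T) ⊎ (a ≡ t)

infixr 5 _⊃_

_⊃_ : Bool → Bool → Bool
x ⊃ y = not x Bool.∨ y

_∧~_ _∨~_ _⇒~_ : A → A → Pred A 0ℓ
(a ∧~ b) c = c ₁ ≡ a ₁ Bool.∧ b ₁
(a ∨~ b) c = c ₁ ≡ a ₁ Bool.∨ b ₁
(a ⇒~ b) c = c ₁ ≡ a ₁ ⊃ b ₁

¬~ ∘~ : A → Pred A 0ℓ
¬~ a c = c ₁ ≡ a ₂
∘~ a c = c ₁ Bool.≤ not (a ₁ Bool.∧ a ₂)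

-- The meet of an arbitrary subset of Bool is not a computable function of
-- the subset, so "m is the meet of S" is expressed as a relation.
IsMeet : ∀ {ℓ} → Pred Bool ℓ → Pred Bool ℓ
IsMeet S m = (∀ x → x ∈ S → m Bool.≤ x)
           × (∀ l → (∀ x → x ∈ S → l Bool.≤ x) → l Bool.≤ m)

-- Only ever applied to non-empty X: see `serial` below.
O~ : ∀ {ℓ} → Pred A ℓ → Pred A ℓ
O~ X c = IsMeet (λ b → ∃[ x ] (x ∈ X × b ≡ x ₁)) (c ₁)

record SwapKripkeModel (w r : Level) : Set (lsuc (w ⊔ r)) where
  field
    W        : Set w
    nonEmpty : W
    R        : Rel W r
    serial   : ∀ x → ∃[ y ] R x y
    v        : W → For → A
    v-∧      : ∀ x α β → v x (α ∧ β) ∈ (v x α ∧~ v x β)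
    v-∨      : ∀ x α β → v x (α ∨ β) ∈ (v x α ∨~ v x β)
    v-⇒      : ∀ x α β → v x (α ⇒ β) ∈ (v x α ⇒~ v x β)
    v-¬      : ∀ x α → v x (¬ α) ∈ ¬~ (v x α)
    v-∘      : ∀ x α → v x (∘ α) ∈ ∘~ (v x α)
    v-O      : ∀ x α → v x (O α) ∈ O~ (λ a → ∃[ y ] (R x y × a ≡ v y α))

open SwapKripkeModel using (W; v)

infix 3 _,_⊨_ _,_⊨*_ _⊨[_,_]_

_,_⊨_ : ∀ {w r} (M : SwapKripkeModel w r) → W M → For → Set
M , x ⊨ α = v M x α ∈ 𝒟

_,_⊨*_ : ∀ {w r ℓ} (M : SwapKripkeModel w r) → W M → Pred For ℓ → Set ℓ
M , x ⊨* Γ = ∀ γ → γ ∈ Γ → M , x ⊨ γ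

-- The levels are those of the sets of worlds and of the accessibility
-- relations over which the models range.
_⊨[_,_]_ : ∀ {ℓ} → Pred For ℓ → (w r : Level) → For → Set (ℓ ⊔ lsuc (w ⊔ r))
Γ ⊨[ w , r ] α =
  (M : SwapKripkeModel w r) (x : W M) → M , x ⊨* Γ → M , x ⊨ α

{-# OPTIONS --safe #-}
module Submission where

-- A value is designated exactly when its first component is true, and on first
-- components →, ∧, ∨ and O act as in a classical Kripke model.  The only other
-- facts needed are that no a has a₁ = a₂ = 0, which gives (EM), and that ⊥[ α ]
-- holds at no world, which gives (bc) and, with seriality, (O-E).

open import Defs
open import Data.Bool.Base as Bool using (true; false; b≤b)
open import Data.Bool.Properties using (∧-conicalˡ; ∧-conicalʳ; not-¬)
open import Data.Empty using (⊥; ⊥-elim)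
open import Data.List.NonEmpty.Base using (_∷_)
open import Data.List.NonEmpty.Relation.Unary.All using (_∷_)
open import Data.List.Relation.Unary.All as List using ([]; _∷_)
open import Data.Product.Base using (_×_; _,_; proj₁; proj₂)
open import Data.Sum.Base as Sum using (_⊎_; inj₁; inj₂; [_,_]′)
open import Function.Base using (_∘′_)
open import Level using (Level)
open import Relation.Binary.PropositionalEquality using (_≡_; refl; sym; trans; subst)
open import Relation.Unary using (Pred)

∧-true⁺ : ∀ {a b} → a ≡ true → b ≡ true → a Bool.∧ b ≡ true
∧-true⁺ refl q = q

∨-true⁻ : ∀ {a b} → a Bool.∨ b ≡ true → a ≡ true ⊎ b ≡ true
∨-true⁻ {true}  _ = inj₁ refl
∨-true⁻ {false} q = inj₂ q

∨-true⁺ : ∀ {a b} → a ≡ true ⊎ b ≡ true → a Bool.∨ b ≡ true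
∨-true⁺         (inj₁ refl) = refl
∨-true⁺ {true}  (inj₂ _)    = refl
∨-true⁺ {false} (inj₂ q)    = q

⊃-true⁻ : ∀ {a b} → a ⊃ b ≡ true → a ≡ true → b ≡ true
⊃-true⁻ p refl = p

⊃-true⁺ : ∀ {a b} → (a ≡ true → b ≡ true) → a ⊃ b ≡ true
⊃-true⁺ {true}  f = f refl
⊃-true⁺ {false} _ = refl

true-≤ : ∀ {a b} → a Bool.≤ b → a ≡ true → b ≡ true
-- The other constructor, `f≤t`, would make `a` false, against `a ≡ true`.
true-≤ b≤b p = p

≤-true : ∀ {a} → true Bool.≤ a → a ≡ true
≤-true p = true-≤ p refl

₁∨₂ : ∀ a → a ₁ ≡ true ⊎ a ₂ ≡ true
₁∨₂ T = inj₁ refl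
₁∨₂ t = inj₁ refl
₁∨₂ F = inj₂ refl

𝒟⇒₁ : ∀ {a} → 𝒟 a → a ₁ ≡ true
𝒟⇒₁ (inj₁ refl) = refl
𝒟⇒₁ (inj₂ refl) = refl

₁⇒𝒟 : ∀ {a} → a ₁ ≡ true → 𝒟 a
₁⇒𝒟 {T} _ = inj₁ refl
₁⇒𝒟 {t} _ = inj₂ refl

module Soundness {w r} (M : SwapKripkeModel w r) where
  open SwapKripkeModel M

  infix 3 _⊩_

  -- A record rather than a synonym, so that x and α can be inferred.
  record _⊩_ (x : W) (α : For) : Set where
    constructor holds
    field first : v x α ₁ ≡ true
  open _⊩_

  ⊩-∧⁻ : ∀ {x α β} → x ⊩ α ∧ β → x ⊩ α × x ⊩ β
  ⊩-∧⁻ {x} {α} {β} (holds p) =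
    holds (∧-conicalˡ _ _ e) , holds (∧-conicalʳ _ _ e)
    where e = trans (sym (v-∧ x α β)) p

  ⊩-∧⁺ : ∀ {x α β} → x ⊩ α → x ⊩ β → x ⊩ α ∧ β
  ⊩-∧⁺ (holds p) (holds q) = holds (trans (v-∧ _ _ _) (∧-true⁺ p q))

  ⊩-∨⁻ : ∀ {x α β} → x ⊩ α ∨ β → x ⊩ α ⊎ x ⊩ β
  ⊩-∨⁻ {x} {α} {β} (holds p) =
    Sum.map holds holds (∨-true⁻ (trans (sym (v-∨ x α β)) p))

  ⊩-∨⁺₁ : ∀ {x α β} → x ⊩ α → x ⊩ α ∨ β
  ⊩-∨⁺₁ (holds p) = holds (trans (v-∨ _ _ _) (∨-true⁺ (inj₁ p)))

  ⊩-∨⁺₂ : ∀ {x α β} → x ⊩ β → x ⊩ α ∨ β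
  ⊩-∨⁺₂ (holds q) = holds (trans (v-∨ _ _ _) (∨-true⁺ (inj₂ q)))

  ⊩-⇒⁻ : ∀ {x α β} → x ⊩ α ⇒ β → x ⊩ α → x ⊩ β
  ⊩-⇒⁻ {x} {α} {β} (holds p) (holds q) = holds (⊃-true⁻ (trans (sym (v-⇒ x α β)) p) q)

  ⊩-⇒⁺ : ∀ {x α β} → (x ⊩ α → x ⊩ β) → x ⊩ α ⇒ β
  ⊩-⇒⁺ f = holds (trans (v-⇒ _ _ _) (⊃-true⁺ (first ∘′ f ∘′ holds)))

  ⊩-em : ∀ x α → x ⊩ α ⊎ x ⊩ ¬ α
  ⊩-em x α = Sum.map holds (holds ∘′ trans (v-¬ x α)) (₁∨₂ (v x α))

  -- First components are Booleans, so the case split is constructive; when that of `α` is false,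
  -- the implication holds vacuously.
  ⊩-⇒-em : ∀ x α β → x ⊩ α ⊎ x ⊩ α ⇒ β
  ⊩-⇒-em x α β with v x α ₁ in eq
  ... | true  = inj₁ (holds eq)
  ... | false = inj₂ (⊩-⇒⁺ λ (holds p) → ⊥-elim (not-¬ eq p))

  -- If `α` and `¬ α` both hold, the value of `α` must be `t`: `F` fails `α`, and `T` forces `¬ α`
  -- to fail. But at `t` the bound in `∘~` is false, so `∘ α` fails.
  ⊩-∘-explosive : ∀ {x α} → x ⊩ ∘ α → x ⊩ α → x ⊩ ¬ α → ⊥
  ⊩-∘-explosive {x} {α} (holds p) (holds q) (holds n)
    with v x α | v-∘ x α | v-¬ x α
  ... | T | _ | e with () ← trans (sym e) n
  ... | t | c | _ with () ← true-≤ c p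

  ⊩-⊥ : ∀ {x α} → x ⊩ ⊥[ α ] → ⊥
  ⊩-⊥ p with q , c ← ⊩-∧⁻ p with a , n ← ⊩-∧⁻ q = ⊩-∘-explosive c a n

  -- The meet is a lower bound of the first components at the successors.
  ⊩-O⁻ : ∀ {x α} → x ⊩ O α → ∀ {y} → R x y → y ⊩ α
  ⊩-O⁻ {x} {α} (holds p) {y} xRy =
    holds (true-≤ (proj₁ (v-O x α) _ (_ , (y , xRy , refl) , refl)) p)

  -- The meet is the greatest lower bound: `true` bounds the first components at all successors from
  -- below, hence also the meet.
  ⊩-O⁺ : ∀ {x α} → (∀ {y} → R x y → y ⊩ α) → x ⊩ O α
  ⊩-O⁺ {x} {α} f = holds (≤-true (proj₂ (v-O x α) true
    λ { _ (_ , (_ , xRy , refl) , refl) → subst (true Bool.≤_) (sym (first (f xRy))) b≤b }))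

  axiom-sound : ∀ {α} → Axiom α → ∀ x → x ⊩ α
  axiom-sound (⇒-K _ _)   _ = ⊩-⇒⁺ λ a → ⊩-⇒⁺ λ _ → a
  axiom-sound (⇒-S _ _ _) _ = ⊩-⇒⁺ λ f → ⊩-⇒⁺ λ g → ⊩-⇒⁺ λ a → ⊩-⇒⁻ (⊩-⇒⁻ f a) (⊩-⇒⁻ g a)
  axiom-sound (∧-I _ _)   _ = ⊩-⇒⁺ λ a → ⊩-⇒⁺ λ b → ⊩-∧⁺ a b
  axiom-sound (∧-E₁ _ _)  _ = ⊩-⇒⁺ (proj₁ ∘′ ⊩-∧⁻)
  axiom-sound (∧-E₂ _ _)  _ = ⊩-⇒⁺ (proj₂ ∘′ ⊩-∧⁻)
  axiom-sound (∨-I₁ _ _)  _ = ⊩-⇒⁺ ⊩-∨⁺₁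
  axiom-sound (∨-I₂ _ _)  _ = ⊩-⇒⁺ ⊩-∨⁺₂
  axiom-sound (∨-E _ _ _) _ =
    ⊩-⇒⁺ λ f → ⊩-⇒⁺ λ g → ⊩-⇒⁺ λ a∨b → [ ⊩-⇒⁻ f , ⊩-⇒⁻ g ]′ (⊩-∨⁻ a∨b)
  axiom-sound (∨-⇒ α β)   x = [ ⊩-∨⁺₁ , ⊩-∨⁺₂ ]′ (⊩-⇒-em x α β)
  axiom-sound (EM α)      x = [ ⊩-∨⁺₁ , ⊩-∨⁺₂ ]′ (⊩-em x α)
  axiom-sound (bc _ _)    _ =
    ⊩-⇒⁺ λ c → ⊩-⇒⁺ λ a → ⊩-⇒⁺ λ n → ⊥-elim (⊩-∘-explosive c a n)
  axiom-sound (O-K _ _)   _ =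
    ⊩-⇒⁺ λ f → ⊩-⇒⁺ λ a → ⊩-O⁺ λ xRy → ⊩-⇒⁻ (⊩-O⁻ f xRy) (⊩-O⁻ a xRy)
  -- The antecedent puts `⊥[ α ]` at the successor of `x` supplied by `serial`, which is absurd.
  axiom-sound (O-E _)     x =
    ⊩-⇒⁺ λ p → ⊥-elim (⊩-⊥ (⊩-O⁻ p (proj₂ (serial x))))

  -- The world is quantified after the derivation because `nec` needs the induction hypothesis at
  -- every successor of `x`.
  theorem-sound : ∀ {α} → ⊢ α → ∀ x → x ⊩ α
  theorem-sound (ax a)   x = axiom-sound a x
  theorem-sound (MP d e) x = ⊩-⇒⁻ (theorem-sound e x) (theorem-sound d x)
  theorem-sound (nec d)  x = ⊩-O⁺ λ {y} _ → theorem-sound d y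

  -- Head and tail are separate arguments so that the recursion can promote the next premise to
  -- head; the base case is a single formula.
  ⊩-⋀ : ∀ {ℓ x γ γs} {Γ : Pred For ℓ} → (∀ {β} → Γ β → x ⊩ β) →
        Γ γ → List.All Γ γs → x ⊩ ⋀ (γ ∷ γs)
  ⊩-⋀ x⊩Γ γ∈Γ []          = x⊩Γ γ∈Γ
  ⊩-⋀ x⊩Γ γ∈Γ (β∈Γ ∷ Γγs) = ⊩-∧⁺ (x⊩Γ γ∈Γ) (⊩-⋀ x⊩Γ β∈Γ Γγs)

  -- The implication from the conjoined premises is itself a theorem, so it holds at `x`, and truth
  -- of the premises at this one world suffices.
  ⊢-sound : ∀ {ℓ φ} {Γ : Pred For ℓ} → Γ ⊢ φ → ∀ x → (∀ {γ} → Γ γ → x ⊩ γ) → x ⊩ φ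
  ⊢-sound (inj₁ d)                   x _   = theorem-sound d x
  ⊢-sound (inj₂ (_ , γ∈Γ ∷ Γγs , d)) x x⊩Γ = ⊩-⇒⁻ (theorem-sound d x) (⊩-⋀ x⊩Γ γ∈Γ Γγs)

theorem2p10 : ∀ {ℓ w r : Level} (Γ : Pred For ℓ) (φ : For) → Γ ⊢ φ → Γ ⊨[ w , r ] φ
theorem2p10 Γ φ d M x x⊨Γ = ₁⇒𝒟 (_⊩_.first (⊢-sound d x (λ γ∈Γ → holds (𝒟⇒₁ (x⊨Γ _ γ∈Γ)))))
  where open Soundness M
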